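{- Let $\varphi$ be a sentence of the monadic second-order language of graphs. Then for every $n\in\mathbb{N}$, the set $\{\,G\in\mathfrak{G}_n : \models_{\Omega(G)}\varphi\,\}$ is $\mathfrak{G}$-recognisable, where $\mathfrak{G}_n$ is the set of finite graphs of type $n$ and $\mathfrak{G}$ is the algebra of finite graphs.
   Context: Graphs. $\mathbb{N}$ contains $0$. A graph is $G=(V,E,\langle\_\rangle)$ with $V$ a finite nonempty set of vertices, $E$ a finite set of edges disjoint from $V$, and $\langle\_\rangle:E\to V^*$ assigning to every edge $e$ a nonempty finite word of vertices (its end points); $|e|$ denotes the length of $\langle e\rangle$. (So graphs are hypergraphs; parallel edges and repeated end points are allowed.) A graph of type $n\in\mathbb{N}$ is a graph together with a (not necessarily injective) map $t:\{1,\dots,n\}\to V$; the $t(i)$ are its terminals. $\mathfrak{G}_n$ is the set of graphs of type $n$; names of vertices and edges are immaterial, i.e. two typed graphs are identified if there are bijections of vertices and edges preserving the words $\langle e\rangle$ and the map $t$. Monadic second-order language of graphs. Formulas are built with $\neg,\wedge,\forall$ (other connectives and $\exists$ being abbreviations) from individual variables and set variables (unary predicate variables), with atomic formulas $\mathrm{vert}(x)$, $\mathrm{edge}(x)$, $x=y$, $X(x)$ and, for each $m\in\mathbb{N}$, $\mathrm{conn}_m(y,x_1,\dots,x_m)$; quantification is over individual variables and set variables. A sentence is a formula without free variables. In the structure $\Omega(G)$ induced by a graph $G$, individual variables range over $V\cup E$, set variables range over all subsets of $V$ and all subsets of $E$, $\mathrm{vert}$ and $\mathrm{edge}$ mean membership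 in $V$ and $E$, $X(x)$ means $x\in X$, and $\mathrm{conn}_m(y,x_1,\dots,x_m)$ holds iff $y\in E$ and $\langle y\rangle=x_1\cdots x_m$. (Terminals are not visible.) $\models_{\Omega(G)}\varphi$ means $\varphi$ is true in $\Omega(G)$. Algebras. A signature $\mathscr{S}=(\mathscr{T},\mathscr{F},\langle\_\rangle)$ consists of a set $\mathscr T$ of sorts, a set $\mathscr F$ of function symbols and a typing $\langle f\rangle=(t_1\cdots t_r,t)\in\mathscr{T}^*\times\mathscr{T}$ for $f\in\mathscr{F}$. An $\mathscr{S}$-algebra $\mathscr{A}=(\mathscr{C},\mathscr{O})$ consists of disjoint carrier sets $\mathscr{C}_t$ ($t\in\mathscr{T}$) and operations $\mathscr{O}_f:\mathscr{C}_{t_1}\times\dots\times\mathscr{C}_{t_r}\to\mathscr{C}_t$. An $\mathscr{S}$-algebra morphism is a sort-indexed family of maps of carriers commuting with all operations. An algebra is locally finite if each carrier is finite. For $t\in\mathscr T$, a subset $\mathscr{L}\subseteq\mathscr{C}_t$ is $\mathscr{A}$-recognisable if there are a locally finite $\mathscr{S}$-algebra $\mathscr{B}$ with carriers $\mathscr{D}_u$, an $\mathscr{S}$-algebra morphism $h=(h_u)_u:\mathscr{A}\to\mathscr{B}$ and a subset $\mathscr{M}\subseteq\mathscr{D}_t$ with $\mathscr{L}=h_t^{ -1}(\mathscr{M})$. The algebra $\mathfrak{G}$. Its sorts are the elements of $\mathbb{N}$, its carriers are the $\mathfrak{G}_n$, and its operations are: (i) for all $n,m$, the disjoint sum $\oplus:\mathfrak{G}_n\times\mathfrak{G}_m\to\mathfrak{G}_{n+m}$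 (disjoint union, terminals of the first graph followed by those of the second); (ii) for every map $\sigma:\{1,\dots,n\}\to\{1,\dots,m\}$ the terminal redefinition $\mathfrak{G}_m\to\mathfrak{G}_n$, $(G,t)\mapsto(G,t\circ\sigma)$; (iii) for $a,b\in\{1,\dots,n\}$ the fusion $\mathfrak{G}_n\to\mathfrak{G}_n$ identifying the vertices $t(a)$ and $t(b)$ (all edges kept, words and terminal map transported along the identification; the identity if $t(a)=t(b)$); (iv) the constant $\mathfrak{v}\in\mathfrak{G}_1$ (one vertex, no edges, the vertex is the terminal) and for $n\ge1$ the constant $\mathfrak{e}_n\in\mathfrak{G}_n$ ($n$ distinct vertices $v_1,\dots,v_n$, one edge $e$ with $\langle e\rangle=v_1\cdots v_n$, $t(i)=v_i$). -}

module Defs where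

open import Data.Empty using (⊥)
open import Data.Fin using (Fin; zero; suc; _↑ˡ_; _↑ʳ_; splitAt; punchOut; punchIn; _≟_)
open import Data.Fin.Properties
  using (+↔⊎; splitAt-↑ˡ; splitAt-↑ʳ; join-splitAt; punchOut-injective; punchOut-cong;
         punchOut-punchIn; punchInᵢ≢i)
open import Data.Fin.Subset using (Subset; _∈_)
import Data.List as List
open import Data.List using (List; []; _∷_; length)
open import Data.List.NonEmpty as List⁺ using (List⁺; _∷_; toList)
import Data.List.NonEmpty.Properties as List⁺
open import Data.Nat using (ℕ; zero; suc; _+_)
open import Data.Product using (∃; _×_; _,_; proj₁; proj₂)
open import Data.Sum using (_⊎_; inj₁; inj₂)
open import Data.Sum.Function.Propositional using (_⊎-↔_)
open import Data.Unit using (⊤)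
open import Data.Vec as Vec using (Vec)
open import Data.Vec.Functional as Vector using (Vector; _++_)
open import Data.Vec.Functional.Properties using (lookup-++ˡ; lookup-++ʳ)
open import Function using (id; _∘_)
open import Function.Bundles using (Func; Inverse; _↔_; _⇔_; mk↔ₛ′)
open import Function.Construct.Composition using (_↔-∘_)
open import Function.Construct.Identity using (↔-id)
open import Function.Construct.Symmetry using (↔-sym)
open import Level using (0ℓ)
open import Relation.Binary using (Setoid)
open import Relation.Binary.PropositionalEquality
  using (_≡_; _≢_; refl; sym; trans; cong; setoid; module ≡-Reasoning)
open import Relation.Nullary using (¬_; yes; no; contradiction)
open import Relation.Unary using (Pred)

open Inverse using (to; from; strictlyInverseˡ; strictlyInverseʳ)

record Signature : Set₁ where
  field
    Sort   : Set
    Symbol : Set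
    ⟨_⟩    : Symbol → List Sort × Sort

  dom : Symbol → List Sort
  dom f = proj₁ ⟨ f ⟩

  cod : Symbol → Sort
  cod f = proj₂ ⟨ f ⟩

-- Carriers are setoids, so that graphs can be identified up to isomorphism;
-- they are pairwise disjoint because they are indexed by the sorts.
record Algebra (S : Signature) : Set₁ where
  open Signature S
  field
    carrier : Sort → Setoid 0ℓ 0ℓ

  ∣_∣ : Sort → Set
  ∣ t ∣ = Setoid.Carrier (carrier t)

  _≈_ : ∀ {t} → ∣ t ∣ → ∣ t ∣ → Set
  _≈_ {t} = Setoid._≈_ (carrier t)

  -- The product of the carriers along a word of sorts.
  Args : List Sort → Set
  Args ts = (i : Fin (length ts)) → ∣ List.lookup ts i ∣

  field
    op      : (f : Symbol) → Args (dom f) → ∣ cod f ∣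
    op-cong : (f : Symbol) {xs ys : Args (dom f)} →
              (∀ i → xs i ≈ ys i) → op f xs ≈ op f ys

record Morphism {S : Signature} (A B : Algebra S) : Set where
  open Signature S
  private
    module A = Algebra A
    module B = Algebra B
  field
    hom : (t : Sort) → Func (A.carrier t) (B.carrier t)

  ⟦_⟧ : ∀ {t} → A.∣ t ∣ → B.∣ t ∣
  ⟦_⟧ {t} = Func.to (hom t)

  field
    commutes : (f : Symbol) (xs : A.Args (dom f)) →
               ⟦ A.op f xs ⟧ B.≈ B.op f (λ i → ⟦ xs i ⟧)

IsFinite : Setoid 0ℓ 0ℓ → Set
IsFinite D = ∃ λ k → Inverse D (setoid (Fin k))

LocallyFinite : {S : Signature} → Algebra S → Set
LocallyFinite {S} B = (t : Signature.Sort S) → IsFinite (Algebra.carrier B t)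

-- L is not required to respect the equality of A in advance: this follows
-- from M-resp and L≡h⁻¹M.
record Recognisable {S : Signature} (A : Algebra S) (t : Signature.Sort S)
                    (L : Pred (Algebra.∣_∣ A t) 0ℓ) : Set₁ where
  field
    B      : Algebra S
    finite : LocallyFinite B
    h      : Morphism A B
    M      : Pred (Algebra.∣_∣ B t) 0ℓ
    M-resp : ∀ {x y} → Algebra._≈_ B x y → M x → M y
    L≡h⁻¹M : ∀ x → L x ⇔ M (Morphism.⟦_⟧ h x)

-- The vertices are Fin (suc v), which makes the vertex set nonempty.
record Graph : Set where
  field
    {v e} : ℕ
    ends  : Vector (List⁺ (Fin (suc v))) e

  Vertex : Set
  Vertex = Fin (suc v)

  Edge : Set
  Edge = Fin e

record TypedGraph (n : ℕ) : Set where
  field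
    graph    : Graph
    terminal : Vector (Graph.Vertex graph) n

  open Graph graph public

record _≅_ {n : ℕ} (G H : TypedGraph n) : Set where
  private
    module G = TypedGraph G
    module H = TypedGraph H
  field
    vertices  : G.Vertex ↔ H.Vertex
    edges     : G.Edge ↔ H.Edge
    ends      : ∀ x → H.ends (to edges x) ≡ List⁺.map (to vertices) (G.ends x)
    terminals : ∀ i → H.terminal i ≡ to vertices (G.terminal i)

≅-refl : ∀ {n} {G : TypedGraph n} → G ≅ G
≅-refl = record
  { vertices  = ↔-id _
  ; edges     = ↔-id _
  ; ends      = λ _ → sym (List⁺.map-id _)
  ; terminals = λ _ → refl
  }

≅-sym : ∀ {n} {G H : TypedGraph n} → G ≅ H → H ≅ G
≅-sym {G = G} {H} α = record
  { vertices  = ↔-sym vertices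
  ; edges     = ↔-sym edges
  ; ends      = λ x → begin
      G.ends (from edges x)
        ≡⟨ List⁺.map-id _ ⟨
      List⁺.map id (G.ends (from edges x))
        ≡⟨ List⁺.map-cong (λ y → sym (strictlyInverseʳ vertices y)) _ ⟩
      List⁺.map (from vertices ∘ to vertices) (G.ends (from edges x))
        ≡⟨ List⁺.map-∘ _ ⟩
      List⁺.map (from vertices) (List⁺.map (to vertices) (G.ends (from edges x)))
        ≡⟨ cong (List⁺.map (from vertices)) (ends (from edges x)) ⟨
      List⁺.map (from vertices) (H.ends (to edges (from edges x)))
        ≡⟨ cong (List⁺.map (from vertices) ∘ H.ends) (strictlyInverseˡ edges x) ⟩
      List⁺.map (from vertices) (H.ends x) ∎
  ; terminals = λ i → sym (trans (cong (from vertices) (terminals i))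
                                 (strictlyInverseʳ vertices _))
  }
  where
  open ≡-Reasoning
  open _≅_ α
  module G = TypedGraph G
  module H = TypedGraph H

≅-trans : ∀ {n} {G H K : TypedGraph n} → G ≅ H → H ≅ K → G ≅ K
≅-trans α β = record
  { vertices  = β.vertices ↔-∘ α.vertices
  ; edges     = β.edges ↔-∘ α.edges
  ; ends      = λ x → trans (β.ends _)
                  (trans (cong (List⁺.map (to β.vertices)) (α.ends x))
                         (sym (List⁺.map-∘ _)))
  ; terminals = λ i → trans (β.terminals i) (cong (to β.vertices) (α.terminals i))
  }
  where
  module α = _≅_ α
  module β = _≅_ β

𝔊-carrier : ℕ → Setoid 0ℓ 0ℓ
𝔊-carrier n = record
  { Carrier       = TypedGraph n
  ; _≈_           = _≅_
  ; isEquivalence = record { refl = ≅-refl ; sym = ≅-sym ; trans = ≅-trans }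
  }

-- The quotient of Fin (suc v) by the least equivalence relation that
-- identifies x and y.
record Identification {v : ℕ} (x y : Fin (suc v)) : Set where
  field
    {w}        : ℕ
    π          : Fin (suc v) → Fin (suc w)
    section    : Fin (suc w) → Fin (suc v)
    π-section  : ∀ c → π (section c) ≡ c
    identifies : π x ≡ π y
    reflects   : ∀ {a b} → π a ≡ π b →
                 a ≡ b ⊎ (a ≡ x × b ≡ y) ⊎ (a ≡ y × b ≡ x)

identify : ∀ {v} (x y : Fin (suc v)) → Identification x y
identify {zero} zero zero = record
  { π          = id
  ; section    = id
  ; π-section  = λ _ → refl
  ; identifies = refl
  ; reflects   = inj₁
  }
identify {suc v} x y with x ≟ y
... | yes x≡y = record
  { π          = id
  ; section    = id
  ; π-section  = λ _ → refl
  ; identifies = x≡y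
  ; reflects   = inj₁
  }
... | no x≢y = record
  { π          = π
  ; section    = punchIn y
  ; π-section  = π-section
  ; identifies = identifies
  ; reflects   = reflects _ _
  }
  where
  π : Fin (suc (suc v)) → Fin (suc v)
  π z with y ≟ z
  ... | yes _  = punchOut (x≢y ∘ sym)
  ... | no y≢z = punchOut y≢z

  π-section : ∀ c → π (punchIn y c) ≡ c
  π-section c with y ≟ punchIn y c
  ... | yes y≡ = contradiction (sym y≡) (punchInᵢ≢i y c)
  ... | no _   = trans (punchOut-cong y refl) (punchOut-punchIn y)

  identifies : π x ≡ π y
  identifies with y ≟ x | y ≟ y
  ... | yes y≡x | _       = contradiction (sym y≡x) x≢y
  ... | no _    | yes _   = punchOut-cong y refl
  ... | no _    | no y≢y  = contradiction refl y≢y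

  reflects : ∀ a b → π a ≡ π b → a ≡ b ⊎ (a ≡ x × b ≡ y) ⊎ (a ≡ y × b ≡ x)
  reflects a b eq with y ≟ a | y ≟ b
  ... | yes y≡a | yes y≡b = inj₁ (trans (sym y≡a) y≡b)
  ... | yes y≡a | no y≢b  = inj₂ (inj₂ (sym y≡a , sym (punchOut-injective _ y≢b eq)))
  ... | no y≢a  | yes y≡b = inj₂ (inj₁ (punchOut-injective y≢a _ eq , sym y≡b))
  ... | no y≢a  | no y≢b  = inj₁ (punchOut-injective y≢a y≢b eq)

module _ {v v′ : ℕ} {x y : Fin (suc v)} {x′ y′ : Fin (suc v′)}
         (P : Identification x y) (Q : Identification x′ y′) where
  private
    module P = Identification P
    module Q = Identification Q

  kernel-mono : (α : Fin (suc v) → Fin (suc v′)) → x′ ≡ α x → y′ ≡ α y →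
                ∀ {a b} → P.π a ≡ P.π b → Q.π (α a) ≡ Q.π (α b)
  kernel-mono α refl refl eq with P.reflects eq
  ... | inj₁ refl                 = refl
  ... | inj₂ (inj₁ (refl , refl)) = Q.identifies
  ... | inj₂ (inj₂ (refl , refl)) = sym Q.identifies

  transfer-π : (α : Fin (suc v) → Fin (suc v′)) → x′ ≡ α x → y′ ≡ α y →
               ∀ a → Q.π (α (P.section (P.π a))) ≡ Q.π (α a)
  transfer-π α p q a = kernel-mono α p q (P.π-section (P.π a))

module _ {v v′ : ℕ} {x y : Fin (suc v)} {x′ y′ : Fin (suc v′)}
         (P : Identification x y) (Q : Identification x′ y′)
         (α : Fin (suc v) ↔ Fin (suc v′))
         (p : x′ ≡ to α x) (q : y′ ≡ to α y) where
  private
    module P = Identification P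
    module Q = Identification Q

    p⁻¹ : x ≡ from α x′
    p⁻¹ = sym (trans (cong (from α) p) (strictlyInverseʳ α x))

    q⁻¹ : y ≡ from α y′
    q⁻¹ = sym (trans (cong (from α) q) (strictlyInverseʳ α y))

  quotient-↔ : Fin (suc P.w) ↔ Fin (suc Q.w)
  quotient-↔ = mk↔ₛ′ (Q.π ∘ to α ∘ P.section) (P.π ∘ from α ∘ Q.section)
    (λ c → trans (transfer-π P Q (to α) p q (from α (Q.section c)))
             (trans (cong Q.π (strictlyInverseˡ α (Q.section c))) (Q.π-section c)))
    (λ c → trans (transfer-π Q P (from α) p⁻¹ q⁻¹ (to α (P.section c)))
             (trans (cong P.π (strictlyInverseʳ α (P.section c))) (P.π-section c)))

infixr 6 _⊕_

_⊕_ : ∀ {n m} → TypedGraph n → TypedGraph m → TypedGraph (n + m)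
_⊕_ G H = record
  { graph    = record
    { ends = Vector.map (List⁺.map left) G.ends ++ Vector.map (List⁺.map right) H.ends }
  ; terminal = Vector.map left G.terminal ++ Vector.map right H.terminal
  }
  where
  module G = TypedGraph G
  module H = TypedGraph H

  left : G.Vertex → Fin (suc G.v + suc H.v)
  left = _↑ˡ suc H.v

  right : H.Vertex → Fin (suc G.v + suc H.v)
  right = suc G.v ↑ʳ_

redefine : ∀ {n m} → (Fin n → Fin m) → TypedGraph m → TypedGraph n
redefine σ G = record { graph = G.graph ; terminal = G.terminal ∘ σ }
  where module G = TypedGraph G

fuse : ∀ {n} → Fin n → Fin n → TypedGraph n → TypedGraph n
fuse a b G = record
  { graph    = record { ends = List⁺.map π ∘ G.ends }
  ; terminal = π ∘ G.terminal
  }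
  where
  module G = TypedGraph G
  open Identification (identify (G.terminal a) (G.terminal b))

𝔳 : TypedGraph 1
𝔳 = record { graph = record { v = 0 ; ends = Vector.[] } ; terminal = id }

-- Shifted index: 𝔢 n has n + 1 terminals.
𝔢 : (n : ℕ) → TypedGraph (suc n)
𝔢 n = record
  { graph    = record { e = 1 ; ends = λ _ → List⁺.fromVec (Vec.allFin (suc n)) }
  ; terminal = id
  }

+-elim : ∀ {m n} (P : Fin (m + n) → Set) →
         (∀ i → P (i ↑ˡ n)) → (∀ j → P (m ↑ʳ j)) → ∀ k → P k
+-elim {m} {n} P l r k with splitAt m k | join-splitAt m n k
... | inj₁ i | refl = l i
... | inj₂ j | refl = r j

module _ {m m′ n n′ : ℕ} (α : Fin m ↔ Fin m′) (β : Fin n ↔ Fin n′) where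

  _+-↔_ : Fin (m + n) ↔ Fin (m′ + n′)
  _+-↔_ = ↔-sym +↔⊎ ↔-∘ ((α ⊎-↔ β) ↔-∘ +↔⊎)

  +-↔-↑ˡ : ∀ i → to _+-↔_ (i ↑ˡ n) ≡ to α i ↑ˡ n′
  +-↔-↑ˡ i rewrite splitAt-↑ˡ m i n = refl

  +-↔-↑ʳ : ∀ j → to _+-↔_ (m ↑ʳ j) ≡ m′ ↑ʳ to β j
  +-↔-↑ʳ j rewrite splitAt-↑ʳ m n j = refl

map-square : {A B C D : Set} {f : B → D} {g : A → B} {h : C → D} {k : A → C} →
             (∀ x → f (g x) ≡ h (k x)) →
             ∀ xs → List⁺.map f (List⁺.map g xs) ≡ List⁺.map h (List⁺.map k xs)
map-square eq xs =
  trans (sym (List⁺.map-∘ xs)) (trans (List⁺.map-cong eq xs) (List⁺.map-∘ xs))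

⊕-cong : ∀ {n m} {G G′ : TypedGraph n} {H H′ : TypedGraph m} →
         G ≅ G′ → H ≅ H′ → (G ⊕ H) ≅ (G′ ⊕ H′)
⊕-cong {n} {m} {G} {G′} {H} {H′} α β = record
  { vertices  = V
  ; edges     = E
  ; ends      = +-elim _ endsˡ endsʳ
  ; terminals = +-elim _ terminalsˡ terminalsʳ
  }
  where
  open ≡-Reasoning
  module α = _≅_ α
  module β = _≅_ β
  module G = TypedGraph G
  module H = TypedGraph H
  module G′ = TypedGraph G′
  module H′ = TypedGraph H′
  module S = TypedGraph (G ⊕ H)
  module S′ = TypedGraph (G′ ⊕ H′)

  V : S.Vertex ↔ S′.Vertex
  V = _+-↔_ α.vertices β.vertices

  E : S.Edge ↔ S′.Edge
  E = _+-↔_ α.edges β.edges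

  V-ˡ : ∀ i → to α.vertices i ↑ˡ suc H′.v ≡ to V (i ↑ˡ suc H.v)
  V-ˡ i = sym (+-↔-↑ˡ α.vertices β.vertices i)

  V-ʳ : ∀ i → suc G′.v ↑ʳ to β.vertices i ≡ to V (suc G.v ↑ʳ i)
  V-ʳ i = sym (+-↔-↑ʳ α.vertices β.vertices i)

  endsˡ : ∀ x → S′.ends (to E (x ↑ˡ H.e)) ≡ List⁺.map (to V) (S.ends (x ↑ˡ H.e))
  endsˡ x = begin
    S′.ends (to E (x ↑ˡ H.e))
      ≡⟨ cong S′.ends (+-↔-↑ˡ α.edges β.edges x) ⟩
    S′.ends (to α.edges x ↑ˡ H′.e)
      ≡⟨ lookup-++ˡ (List⁺.map (_↑ˡ suc H′.v) ∘ G′.ends) _ (to α.edges x) ⟩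
    List⁺.map (_↑ˡ suc H′.v) (G′.ends (to α.edges x))
      ≡⟨ cong (List⁺.map _) (α.ends x) ⟩
    List⁺.map (_↑ˡ suc H′.v) (List⁺.map (to α.vertices) (G.ends x))
      ≡⟨ map-square V-ˡ (G.ends x) ⟩
    List⁺.map (to V) (List⁺.map (_↑ˡ suc H.v) (G.ends x))
      ≡⟨ cong (List⁺.map (to V)) (lookup-++ˡ (List⁺.map (_↑ˡ suc H.v) ∘ G.ends) _ x) ⟨
    List⁺.map (to V) (S.ends (x ↑ˡ H.e)) ∎

  endsʳ : ∀ x → S′.ends (to E (G.e ↑ʳ x)) ≡ List⁺.map (to V) (S.ends (G.e ↑ʳ x))
  endsʳ x = begin
    S′.ends (to E (G.e ↑ʳ x))
      ≡⟨ cong S′.ends (+-↔-↑ʳ α.edges β.edges x) ⟩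
    S′.ends (G′.e ↑ʳ to β.edges x)
      ≡⟨ lookup-++ʳ (List⁺.map (_↑ˡ suc H′.v) ∘ G′.ends) _ (to β.edges x) ⟩
    List⁺.map (suc G′.v ↑ʳ_) (H′.ends (to β.edges x))
      ≡⟨ cong (List⁺.map _) (β.ends x) ⟩
    List⁺.map (suc G′.v ↑ʳ_) (List⁺.map (to β.vertices) (H.ends x))
      ≡⟨ map-square V-ʳ (H.ends x) ⟩
    List⁺.map (to V) (List⁺.map (suc G.v ↑ʳ_) (H.ends x))
      ≡⟨ cong (List⁺.map (to V)) (lookup-++ʳ (List⁺.map (_↑ˡ suc H.v) ∘ G.ends) _ x) ⟨
    List⁺.map (to V) (S.ends (G.e ↑ʳ x)) ∎

  terminalsˡ : ∀ i → S′.terminal (i ↑ˡ m) ≡ to V (S.terminal (i ↑ˡ m))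
  terminalsˡ i = begin
    S′.terminal (i ↑ˡ m)
      ≡⟨ lookup-++ˡ ((_↑ˡ suc H′.v) ∘ G′.terminal) _ i ⟩
    G′.terminal i ↑ˡ suc H′.v
      ≡⟨ cong (_↑ˡ suc H′.v) (α.terminals i) ⟩
    to α.vertices (G.terminal i) ↑ˡ suc H′.v
      ≡⟨ V-ˡ (G.terminal i) ⟩
    to V (G.terminal i ↑ˡ suc H.v)
      ≡⟨ cong (to V) (lookup-++ˡ ((_↑ˡ suc H.v) ∘ G.terminal) _ i) ⟨
    to V (S.terminal (i ↑ˡ m)) ∎

  terminalsʳ : ∀ i → S′.terminal (n ↑ʳ i) ≡ to V (S.terminal (n ↑ʳ i))
  terminalsʳ i = begin
    S′.terminal (n ↑ʳ i)
      ≡⟨ lookup-++ʳ ((_↑ˡ suc H′.v) ∘ G′.terminal) _ i ⟩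
    suc G′.v ↑ʳ H′.terminal i
      ≡⟨ cong (suc G′.v ↑ʳ_) (β.terminals i) ⟩
    suc G′.v ↑ʳ to β.vertices (H.terminal i)
      ≡⟨ V-ʳ (H.terminal i) ⟩
    to V (suc G.v ↑ʳ H.terminal i)
      ≡⟨ cong (to V) (lookup-++ʳ ((_↑ˡ suc H.v) ∘ G.terminal) _ i) ⟨
    to V (S.terminal (n ↑ʳ i)) ∎

redefine-cong : ∀ {n m} (σ : Fin n → Fin m) {G H : TypedGraph m} →
                G ≅ H → redefine σ G ≅ redefine σ H
redefine-cong σ α = record
  { vertices  = vertices
  ; edges     = edges
  ; ends      = ends
  ; terminals = terminals ∘ σ
  }
  where open _≅_ α

fuse-cong : ∀ {n} (a b : Fin n) {G H : TypedGraph n} → G ≅ H → fuse a b G ≅ fuse a b H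
fuse-cong a b {G} {H} α = record
  { vertices  = quotient-↔ P Q vertices (terminals a) (terminals b)
  ; edges     = edges
  ; ends      = λ x → trans (cong (List⁺.map Q.π) (ends x))
                        (map-square (sym ∘ transfer) (G.ends x))
  ; terminals = λ i → trans (cong Q.π (terminals i)) (sym (transfer (G.terminal i)))
  }
  where
  open _≅_ α
  module G = TypedGraph G
  module H = TypedGraph H

  P : Identification (G.terminal a) (G.terminal b)
  P = identify _ _

  Q : Identification (H.terminal a) (H.terminal b)
  Q = identify _ _

  module P = Identification P
  module Q = Identification Q

  transfer : ∀ z → Q.π (to vertices (P.section (P.π z))) ≡ Q.π (to vertices z)
  transfer = transfer-π P Q (to vertices) (terminals a) (terminals b)

data GraphSymbol : Set where
  sum          : (n m : ℕ) → GraphSymbol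
  redefinition : {n m : ℕ} → (Fin n → Fin m) → GraphSymbol
  fusion       : {n : ℕ} → Fin n → Fin n → GraphSymbol
  vertex       : GraphSymbol
  edge         : ℕ → GraphSymbol

graphSignature : Signature
graphSignature = record { Sort = ℕ ; Symbol = GraphSymbol ; ⟨_⟩ = typing }
  where
  typing : GraphSymbol → List ℕ × ℕ
  typing (sum n m)                = n ∷ m ∷ [] , n + m
  typing (redefinition {n} {m} σ) = m ∷ [] , n
  typing (fusion {n} a b)         = n ∷ [] , n
  typing vertex                   = [] , 1
  typing (edge n)                 = [] , suc n

𝔊 : Algebra graphSignature
𝔊 = record
  { carrier = 𝔊-carrier
  ; op      = λ where
      (sum n m)        Gs → Gs zero ⊕ Gs (suc zero)
      (redefinition σ) Gs → redefine σ (Gs zero)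
      (fusion a b)     Gs → fuse a b (Gs zero)
      vertex           Gs → 𝔳
      (edge n)         Gs → 𝔢 n
  ; op-cong = λ where
      (sum n m)        αs → ⊕-cong (αs zero) (αs (suc zero))
      (redefinition σ) αs → redefine-cong σ (αs zero)
      (fusion a b)     αs → fuse-cong a b (αs zero)
      vertex           αs → ≅-refl
      (edge n)         αs → ≅-refl
  }

infix  8 _≐_ _∋_
infix  7 ~_
infixr 6 _∧_
infix  5 ∀₁_ ∀₂_

-- Formulas with i free individual variables and s free set variables,
-- in de Bruijn style: each quantifier binds the variable zero.
data Formula (i s : ℕ) : Set where
  vert  : Fin i → Formula i s
  edge  : Fin i → Formula i s
  _≐_   : Fin i → Fin i → Formula i s
  _∋_   : Fin s → Fin i → Formula i s
  conn  : {m : ℕ} → Fin i → Vec (Fin i) m → Formula i s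
  ~_    : Formula i s → Formula i s
  _∧_   : Formula i s → Formula i s → Formula i s
  ∀₁_   : Formula (suc i) s → Formula i s
  ∀₂_   : Formula i (suc s) → Formula i s

Sentence : Set
Sentence = Formula 0 0

-- The quantifiers of Sat range over finite sets and its atoms are decidable,
-- so Sat is decidable and agrees with classical truth.
module Ω (G : Graph) where
  open Graph G

  Individual : Set
  Individual = Vertex ⊎ Edge

  -- A subset of V or a subset of E, but no mixture of the two.
  IndividualSet : Set
  IndividualSet = Subset (suc v) ⊎ Subset e

  Vert : Individual → Set
  Vert (inj₁ _) = ⊤
  Vert (inj₂ _) = ⊥

  Edg : Individual → Set
  Edg (inj₁ _) = ⊥
  Edg (inj₂ _) = ⊤

  Member : Individual → IndividualSet → Set
  Member (inj₁ x) (inj₁ X) = x ∈ X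
  Member (inj₂ x) (inj₂ X) = x ∈ X
  Member (inj₁ _) (inj₂ _) = ⊥
  Member (inj₂ _) (inj₁ _) = ⊥

  Conn : ∀ {m} → Individual → Vec Individual m → Set
  Conn (inj₁ _) xs = ⊥
  Conn (inj₂ y) xs = List.map inj₁ (toList (ends y)) ≡ Vec.toList xs

  Sat : ∀ {i s} → Formula i s → Vector Individual i → Vector IndividualSet s → Set
  Sat (vert x)    ρ θ = Vert (ρ x)
  Sat (edge x)    ρ θ = Edg (ρ x)
  Sat (x ≐ y)     ρ θ = ρ x ≡ ρ y
  Sat (X ∋ x)     ρ θ = Member (ρ x) (θ X)
  Sat (conn y xs) ρ θ = Conn (ρ y) (Vec.map ρ xs)
  Sat (~ φ)       ρ θ = ¬ Sat φ ρ θ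
  Sat (φ ∧ ψ)     ρ θ = Sat φ ρ θ × Sat ψ ρ θ
  Sat (∀₁ φ)      ρ θ = ∀ x → Sat φ (x Vector.∷ ρ) θ
  Sat (∀₂ φ)      ρ θ = ∀ X → Sat φ ρ (X Vector.∷ θ)

infix 4 Ω⟨_⟩⊨_

Ω⟨_⟩⊨_ : Graph → Sentence → Set
Ω⟨ G ⟩⊨ φ = Ω.Sat G φ Vector.[] Vector.[]

{-# OPTIONS --safe #-}
-- Sets of vertices and edges behave well under the operations of 𝔊: a set in
-- G ⊕ H is a pair of sets, and a set in a fusion of G is a set in G that does
-- not separate the fused terminals. So individual variables are replaced by
-- singletons, which leaves a single kind of atom, "some vertex or edge has a
-- colour and end points of this kind"; its truth is a disjunction in sums and
-- is unchanged by fusion. Negation and conjunction are immediate, and set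
-- quantifiers are handled by the powerset construction.
module Submission where

open import Defs
open import Data.Bool using (Bool; true; false; not; _∨_) renaming (_∧_ to _∧ᵇ_; _≟_ to _≟ᵇ_)
open import Data.Empty using (⊥)
open import Data.Fin using (Fin; zero; suc; _↑ˡ_; _↑ʳ_; splitAt)
open import Data.Fin.Properties using (any?; 2↔Bool; *↔×) renaming (_≟_ to _≟ᶠ_)
open import Data.Fin.Subset using (Subset)
open import Data.Fin.Subset.Properties using (anySubset?; _∈?_)
open import Data.List as List using (List; []; _∷_)
open import Data.List.NonEmpty as List⁺ using (toList)
import Data.List.Properties as List
open import Data.List.Relation.Binary.Pointwise as Pointwise using (Pointwise; []; _∷_)
open import Data.Maybe using (Maybe; just; nothing)
open import Data.Nat using (ℕ; suc; _+_)
open import Data.Product as Product using (∃; _×_; _,_; proj₁; proj₂; uncurry)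
open import Data.Product.Function.NonDependent.Propositional using (_×-↔_; _×-⇔_)
open import Data.Sum as Sum using (_⊎_; inj₁; inj₂)
open import Data.Sum.Properties using (≡-dec)
open import Data.Unit using (tt)
open import Data.Vec as Vec using (Vec; []; _∷_; lookup; tabulate)
open import Data.Vec.Functional as Vector using (Vector)
open import Data.Vec.Functional.Properties using (lookup-++ˡ; lookup-++ʳ)
open import Data.Vec.Properties
  using (lookup∘tabulate; tabulate-cong; toList-map; []=⇒lookup; lookup⇒[]=)
open import Function using (_∘_; id; _⇔_; mk⇔; _↔_; mk↔ₛ′; Equivalence)
open import Function.Bundles using (Inverse)
open import Function.Construct.Composition using (_↔-∘_; _⇔-∘_)
open import Function.Construct.Symmetry using (↔-sym; ⇔-sym)
open import Function.Properties.Inverse using (↔⇒↣)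
open import Level using (0ℓ)
open import Relation.Binary using (DecidableEquality)
open import Relation.Binary.PropositionalEquality
  using (_≡_; refl; sym; trans; cong; cong₂; subst; setoid; _≗_)
open import Relation.Nullary using (¬_; Dec; yes; no; does; contradiction)
open import Relation.Nullary.Decidable
  using (map′; does-⇔; dec-true; ¬?; _×-dec_; _⊎-dec_; decidable-stable; via-injection)
open import Relation.Unary using (Pred; Decidable)

open Equivalence using () renaming (to to ⇒; from to ⇐)
open Inverse using (to; from; strictlyInverseˡ; strictlyInverseʳ)
open Ω using (Individual; IndividualSet; Member; Sat)
open TypedGraph using (graph; terminal)

-- Finite types and their powersets

Finite : Set → Set
Finite A = IsFinite (setoid A)

does≡true : {A : Set} (a? : Dec A) → does a? ≡ true ⇔ A
does≡true (yes a) = mk⇔ (λ _ → a) (λ _ → refl)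
does≡true (no ¬a) = mk⇔ (λ ()) (λ a → contradiction a ¬a)

finite-× : {A B : Set} → Finite A → Finite B → Finite (A × B)
finite-× (_ , α) (_ , β) = _ , ↔-sym *↔× ↔-∘ (α ×-↔ β)

finite-Bool : Finite Bool
finite-Bool = 2 , ↔-sym 2↔Bool

finite-Subset : ∀ n → Finite (Subset n)
finite-Subset 0       = 1 , mk↔ₛ′ (λ _ → zero) (λ _ → []) (λ { zero → refl ; (suc ()) }) (λ { [] → refl })
finite-Subset (suc n) with k , α ← finite-× finite-Bool (finite-Subset n) =
  k , α ↔-∘ mk↔ₛ′ (λ { (b ∷ X) → b , X }) (uncurry _∷_) (λ _ → refl) (λ { (_ ∷ _) → refl })

module FiniteType {A : Set} (F : Finite A) where
  private
    module F = Inverse (proj₂ F)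

  ∃? : {P : Pred A 0ℓ} → Decidable P → Dec (∃ P)
  ∃? {P} P? = map′ (λ (i , p) → F.from i , p)
                   (λ (x , p) → F.to x , subst P (sym (F.strictlyInverseʳ x)) p)
                   (any? (P? ∘ F.from))

  _≟_ : DecidableEquality A
  _≟_ = via-injection (↔⇒↣ (proj₂ F)) _≟ᶠ_

  -- Bit vectors along the enumeration of `A`, so that subsets with the same members are equal for
  -- `≡`. Predicates `A → Bool` would agree only pointwise, and the states of the finite algebra are
  -- compared by `≡`.
  Powerset : Set
  Powerset = Subset (proj₁ F)

  _∈ₚ_ : A → Powerset → Set
  x ∈ₚ S = lookup S (F.to x) ≡ true

  _∈ₚ?_ : ∀ x S → Dec (x ∈ₚ S)
  x ∈ₚ? S = lookup S (F.to x) ≟ᵇ true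

  ⟦_⟧ : {P : Pred A 0ℓ} → Decidable P → Powerset
  ⟦ P? ⟧ = tabulate (does ∘ P? ∘ F.from)

  ∈-⟦⟧ : {P : Pred A 0ℓ} (P? : Decidable P) {x : A} → x ∈ₚ ⟦ P? ⟧ ⇔ P x
  ∈-⟦⟧ P? {x}
    rewrite lookup∘tabulate (does ∘ P? ∘ F.from) (F.to x) | F.strictlyInverseʳ x =
    does≡true (P? x)

  ⟦⟧-cong : {P Q : Pred A 0ℓ} (P? : Decidable P) (Q? : Decidable Q) →
            (∀ x → P x ⇔ Q x) → ⟦ P? ⟧ ≡ ⟦ Q? ⟧
  ⟦⟧-cong P? Q? P⇔Q = tabulate-cong (λ i → does-⇔ (P⇔Q _) (P? _) (Q? _))

module _ {A B : Set} (F : Finite A) (G : Finite B) {R : A → B → Set}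
         (R? : ∀ x y → Dec (R x y)) where
  private
    module F = FiniteType F
    module G = FiniteType G

  related? : ∀ S y → Dec (∃ λ x → x F.∈ₚ S × R x y)
  related? S y = F.∃? (λ x → (x F.∈ₚ? S) ×-dec R? x y)

  image : F.Powerset → G.Powerset
  image S = G.⟦ related? S ⟧

  -- Serves the two unary operations, redefinition and fusion: there the state of the result is the
  -- direct image, under a relation between profiles, of the state of the argument.
  image-⟦⟧ : {P : Pred A 0ℓ} (P? : Decidable P) {Q : Pred B 0ℓ} (Q? : Decidable Q) →
             (∀ y → Q y ⇔ (∃ λ x → P x × R x y)) → G.⟦ Q? ⟧ ≡ image F.⟦ P? ⟧
  image-⟦⟧ P? Q? Q⇔ = G.⟦⟧-cong Q? (related? F.⟦ P? ⟧) λ y →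
    mk⇔ (Product.map₂ (Product.map₁ (⇐ (F.∈-⟦⟧ P?))) ∘ ⇒ (Q⇔ y))
        (⇐ (Q⇔ y) ∘ Product.map₂ (Product.map₁ (⇒ (F.∈-⟦⟧ P?))))

-- The search runs over pairs of bit vectors. A predicate `f` is met there only as its tabulation,
-- which agrees with it pointwise; hence the hypothesis that `P` respects `≗`.
∃-predicate? : ∀ {m n} {P : (Fin m ⊎ Fin n → Bool) → Set} →
               (∀ {f g} → f ≗ g → P f → P g) → Decidable P → Dec (∃ P)
∃-predicate? {m} {n} {P} resp P? =
  map′ (λ (X , Y , p) → [X,Y] X Y , p)
       (λ (f , p) → tabulate (f ∘ inj₁) , tabulate (f ∘ inj₂) ,
          resp (λ { (inj₁ i) → sym (lookup∘tabulate (f ∘ inj₁) i)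
                  ; (inj₂ j) → sym (lookup∘tabulate (f ∘ inj₂) j) }) p)
       (anySubset? λ X → anySubset? λ Y → P? ([X,Y] X Y))
  where
  [X,Y] : Subset m → Subset n → Fin m ⊎ Fin n → Bool
  [X,Y] X Y = Sum.[ lookup X , lookup Y ]

-- Graph homomorphisms and colourings

-- A common form for the inclusions into a sum, the quotient map of a fusion and isomorphisms.
-- Colourings are always pulled back along such maps.
record Hom (G H : Graph) : Set where
  private
    module G = Graph G
    module H = Graph H
  field
    onVertex : G.Vertex → H.Vertex
    onEdge   : G.Edge → H.Edge
    ends     : ∀ x → H.ends (onEdge x) ≡ List⁺.map onVertex (G.ends x)

  on : Individual G → Individual H
  on = Sum.map onVertex onEdge

open Hom using (on)

module _ {n m} (G : TypedGraph n) (H : TypedGraph m) where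
  private
    module G = TypedGraph G
    module H = TypedGraph H

  inl : Hom (graph G) (graph (G ⊕ H))
  inl = record
    { onVertex = _↑ˡ suc H.v
    ; onEdge   = _↑ˡ H.e
    ; ends     = lookup-++ˡ (List⁺.map (_↑ˡ suc H.v) ∘ G.ends) _
    }

  inr : Hom (graph H) (graph (G ⊕ H))
  inr = record
    { onVertex = suc G.v ↑ʳ_
    ; onEdge   = G.e ↑ʳ_
    ; ends     = lookup-++ʳ (List⁺.map (_↑ˡ suc H.v) ∘ G.ends) _
    }

  ⊕-elim : (P : Individual (graph (G ⊕ H)) → Set) →
           (∀ z → P (on inl z)) → (∀ z → P (on inr z)) → ∀ z → P z
  ⊕-elim P l r (inj₁ x) = +-elim (P ∘ inj₁) (l ∘ inj₁) (r ∘ inj₁) x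
  ⊕-elim P l r (inj₂ x) = +-elim (P ∘ inj₂) (l ∘ inj₂) (r ∘ inj₂) x

  copair : {A : Set} → (Individual (graph G) → A) → (Individual (graph H) → A) →
           Individual (graph (G ⊕ H)) → A
  copair f g (inj₁ x) = ((f ∘ inj₁) Vector.++ (g ∘ inj₁)) x
  copair f g (inj₂ x) = ((f ∘ inj₂) Vector.++ (g ∘ inj₂)) x

  module _ {A : Set} (f : Individual (graph G) → A) (g : Individual (graph H) → A) where

    copair-inl : copair f g ∘ on inl ≗ f
    copair-inl (inj₁ x) = lookup-++ˡ (f ∘ inj₁) _ x
    copair-inl (inj₂ x) = lookup-++ˡ (f ∘ inj₂) _ x

    copair-inr : copair f g ∘ on inr ≗ g
    copair-inr (inj₁ x) = lookup-++ʳ (f ∘ inj₁) _ x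
    copair-inr (inj₂ x) = lookup-++ʳ (f ∘ inj₂) _ x

module _ {n} (a b : Fin n) (G : TypedGraph n) where
  private
    module G = TypedGraph G
    module I = Identification (identify (G.terminal a) (G.terminal b))

  quotient : Hom (graph G) (graph (fuse a b G))
  quotient = record { onVertex = I.π ; onEdge = id ; ends = λ _ → refl }

  quotient-section : Individual (graph (fuse a b G)) → Individual (graph G)
  quotient-section = Sum.map I.section id

  quotient∘section : ∀ z → on quotient (quotient-section z) ≡ z
  quotient∘section (inj₁ x) = cong inj₁ (I.π-section x)
  quotient∘section (inj₂ _) = refl

  quotient-identifies : on quotient (inj₁ (G.terminal a)) ≡ on quotient (inj₁ (G.terminal b))
  quotient-identifies = cong inj₁ I.identifies

  -- Two distinct vertices in one fibre of the quotient map are the two fused terminals. A function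
  -- that agrees on these is therefore constant on fibres, and the choice made by the section does
  -- not change its values.
  section∘quotient : {A : Set} (f : Individual (graph G) → A) →
                     f (inj₁ (G.terminal a)) ≡ f (inj₁ (G.terminal b)) →
                     f ∘ quotient-section ∘ on quotient ≗ f
  section∘quotient f eq (inj₂ _) = refl
  section∘quotient f eq (inj₁ x) with I.reflects (I.π-section (I.π x))
  ... | inj₁ p               = cong (f ∘ inj₁) p
  ... | inj₂ (inj₁ (p , q)) = trans (cong (f ∘ inj₁) p) (trans eq (cong (f ∘ inj₁) (sym q)))
  ... | inj₂ (inj₂ (p , q)) = trans (cong (f ∘ inj₁) p) (trans (sym eq) (cong (f ∘ inj₁) (sym q)))

iso : ∀ {n} {G H : TypedGraph n} → G ≅ H → Hom (graph G) (graph H)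
iso α = record { onVertex = to vertices ; onEdge = to edges ; ends = ends }
  where open _≅_ α

iso-sym : ∀ {n} {G H : TypedGraph n} (α : G ≅ H) →
          ∀ z → on (iso (≅-sym α)) (on (iso α) z) ≡ z
iso-sym α (inj₁ x) = cong inj₁ (strictlyInverseʳ (_≅_.vertices α) x)
iso-sym α (inj₂ x) = cong inj₂ (strictlyInverseʳ (_≅_.edges α) x)

iso-sym′ : ∀ {n} {G H : TypedGraph n} (α : G ≅ H) →
           ∀ z → on (iso α) (on (iso (≅-sym α)) z) ≡ z
iso-sym′ α (inj₁ x) = cong inj₁ (strictlyInverseˡ (_≅_.vertices α) x)
iso-sym′ α (inj₂ x) = cong inj₂ (strictlyInverseˡ (_≅_.edges α) x)

iso-refl : ∀ {n} (G : TypedGraph n) z → on (iso (≅-refl {G = G})) z ≡ z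
iso-refl G (inj₁ _) = refl
iso-refl G (inj₂ _) = refl

-- A colouring encodes k sets of individuals: the x-th bit of a colour tells
-- membership in the x-th set.
Colouring : ℕ → Graph → Set
Colouring k G = Individual G → Vec Bool k

infixr 5 _◂_

_◂_ : {A : Set} {k : ℕ} → (A → Bool) → (A → Vec Bool k) → A → Vec Bool (suc k)
(f ◂ c) z = f z ∷ c z

-- Recognisers of coloured graphs

-- A locally finite algebra with a morphism `state` from coloured graphs. A colouring of a sum or a
-- fusion induces one of each argument, by pullback. The constants are handled through `state`
-- itself, as each of their colourings has its own value. `state-cong` combines invariance under
-- isomorphism with invariance under pointwise equality of colourings.
record Recogniser (k : ℕ) : Set₁ where
  field
    State       : ℕ → Set
    finite      : ∀ n → Finite (State n)
    sum-op      : ∀ {n m} → State n → State m → State (n + m)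
    redefine-op : ∀ {n m} → (Fin n → Fin m) → State m → State n
    fuse-op     : ∀ {n} → Fin n → Fin n → State n → State n

    state          : ∀ {n} (G : TypedGraph n) → Colouring k (graph G) → State n
    state-⊕        : ∀ {n m} (G : TypedGraph n) (H : TypedGraph m) c →
                     state (G ⊕ H) c ≡ sum-op (state G (c ∘ on (inl G H)))
                                              (state H (c ∘ on (inr G H)))
    state-redefine : ∀ {n m} (σ : Fin n → Fin m) (G : TypedGraph m) c →
                     state (redefine σ G) c ≡ redefine-op σ (state G c)
    state-fuse     : ∀ {n} (a b : Fin n) (G : TypedGraph n) c →
                     state (fuse a b G) c ≡ fuse-op a b (state G (c ∘ on (quotient a b G)))
    state-cong     : ∀ {n} {G H : TypedGraph n} (α : G ≅ H) {c d} →
                     c ≗ d ∘ on (iso α) → state G c ≡ state H d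

  state-ext : ∀ {n} (G : TypedGraph n) {c d : Colouring k (graph G)} →
              c ≗ d → state G c ≡ state G d
  state-ext G {c} {d} c≗d =
    state-cong {G = G} ≅-refl (λ z → trans (c≗d z) (cong d (sym (iso-refl G z))))

Property : ℕ → Set₁
Property k = (G : Graph) → Colouring k G → Set

record Regular {k : ℕ} (P : Property k) : Set₁ where
  field
    recogniser : Recogniser k

  open Recogniser recogniser public

  field
    accept  : ∀ {n} → State n → Bool
    correct : ∀ {n} (G : TypedGraph n) c → accept (state G c) ≡ true ⇔ P (graph G) c

  -- Any graph can be given type zero, and the recogniser then decides `P`. This supplies the
  -- classical steps on regular properties.
  holds? : ∀ G c → Dec (P G c)
  holds? G c = map′ (⇒ (correct G₀ c)) (⇐ (correct G₀ c)) (accept (state G₀ c) ≟ᵇ true)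
    where
    G₀ : TypedGraph 0
    G₀ = record { graph = G ; terminal = λ () }

-- Boolean closure of regular properties

regular-resp : ∀ {k} {P Q : Property k} → (∀ G c → P G c ⇔ Q G c) → Regular P → Regular Q
regular-resp P⇔Q r = record
  { recogniser = recogniser
  ; accept     = accept
  ; correct    = λ G c → P⇔Q (graph G) c ⇔-∘ correct G c
  }
  where open Regular r

regular-¬ : ∀ {k} {P : Property k} → Regular P → Regular (λ G c → ¬ P G c)
regular-¬ r = record
  { recogniser = recogniser
  ; accept     = not ∘ accept
  ; correct    = λ G c → negate (correct G c)
  }
  where
  open Regular r

  negate : {b : Bool} {A : Set} → b ≡ true ⇔ A → not b ≡ true ⇔ (¬ A)
  negate {true}  b⇔A = mk⇔ (λ ()) (λ ¬a → contradiction (⇒ b⇔A refl) ¬a)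
  negate {false} b⇔A = mk⇔ (λ _ a → contradiction (⇐ b⇔A a) λ ()) (λ _ → refl)

regular-× : ∀ {k} {P Q : Property k} → Regular P → Regular Q →
            Regular (λ G c → P G c × Q G c)
regular-× r s = record
  { recogniser = record
    { State          = λ n → R.State n × S.State n
    ; finite         = λ n → finite-× (R.finite n) (S.finite n)
    ; sum-op         = Product.zip R.sum-op S.sum-op
    ; redefine-op    = λ σ → Product.map (R.redefine-op σ) (S.redefine-op σ)
    ; fuse-op        = λ a b → Product.map (R.fuse-op a b) (S.fuse-op a b)
    ; state          = λ G c → R.state G c , S.state G c
    ; state-⊕        = λ G H c → cong₂ _,_ (R.state-⊕ G H c) (S.state-⊕ G H c)
    ; state-redefine = λ σ G c → cong₂ _,_ (R.state-redefine σ G c) (S.state-redefine σ G c)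
    ; state-fuse     = λ a b G c → cong₂ _,_ (R.state-fuse a b G c) (S.state-fuse a b G c)
    ; state-cong     = λ α eq → cong₂ _,_ (R.state-cong α eq) (S.state-cong α eq)
    }
  ; accept  = λ (p , q) → R.accept p ∧ᵇ S.accept q
  ; correct = λ G c → conjunction (R.correct G c) (S.correct G c)
  }
  where
  module R = Regular r
  module S = Regular s

  conjunction : {a b : Bool} {A B : Set} → a ≡ true ⇔ A → b ≡ true ⇔ B →
                a ∧ᵇ b ≡ true ⇔ (A × B)
  conjunction {true}  a⇔ b⇔ = mk⇔ (λ b → ⇒ a⇔ refl , ⇒ b⇔ b) (⇐ b⇔ ∘ proj₂)
  conjunction {false} a⇔ b⇔ = mk⇔ (λ ()) (λ (a , _) → ⇐ a⇔ a)

-- The powerset construction. A set of individuals of a fused graph is one of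
-- the original graph that does not separate the fused terminals, so each state
-- is paired with the set of terminals that belong to the quantified set.
module Projection {k : ℕ} (R : Recogniser (suc k)) where
  private
    module R = Recogniser R

  Profile : ℕ → Set
  Profile n = R.State n × Subset n

  finite-Profile : ∀ n → Finite (Profile n)
  finite-Profile n = finite-× (R.finite n) (finite-Subset n)

  private
    module Profiles {n} = FiniteType (finite-Profile n)
  open Profiles

  profile : ∀ {n} (G : TypedGraph n) → Colouring k (graph G) →
            (Individual (graph G) → Bool) → Profile n
  profile G c f = R.state G (f ◂ c) , tabulate (f ∘ inj₁ ∘ terminal G)

  profile-cong : ∀ {n} {G H : TypedGraph n} (α : G ≅ H) {c d f g} →
                 c ≗ d ∘ on (iso α) → f ≗ g ∘ on (iso α) → profile G c f ≡ profile H d g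
  profile-cong α {g = g} c≗ f≗ =
    cong₂ _,_ (R.state-cong α (λ z → cong₂ _∷_ (f≗ z) (c≗ z)))
              (tabulate-cong (λ i →
                trans (f≗ _) (cong (g ∘ inj₁) (sym (_≅_.terminals α i)))))

  profile-ext : ∀ {n} (G : TypedGraph n) c {f g} → f ≗ g → profile G c f ≡ profile G c g
  profile-ext G c f≗ = cong₂ _,_ (R.state-ext G (λ z → cong (_∷ c z) (f≗ z)))
                                 (tabulate-cong (f≗ ∘ inj₁ ∘ terminal G))

  profile-sum : ∀ {n m} → Profile n → Profile m → Profile (n + m)
  profile-sum (s , X) (t , Y) = R.sum-op s t , tabulate (lookup X Vector.++ lookup Y)

  profile-⊕ : ∀ {n m} (G : TypedGraph n) (H : TypedGraph m) c f →
              profile (G ⊕ H) c f ≡ profile-sum (profile G (c ∘ on (inl G H)) (f ∘ on (inl G H)))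
                                                (profile H (c ∘ on (inr G H)) (f ∘ on (inr G H)))
  profile-⊕ {n} {m} G H c f = cong₂ _,_ (R.state-⊕ G H (f ◂ c)) (tabulate-cong bits)
    where
    bits : ∀ i → f (inj₁ (terminal (G ⊕ H) i)) ≡
                 (lookup (tabulate (f ∘ on (inl G H) ∘ inj₁ ∘ terminal G)) Vector.++
                  lookup (tabulate (f ∘ on (inr G H) ∘ inj₁ ∘ terminal H))) i
    bits i with splitAt n i
    ... | inj₁ j = sym (lookup∘tabulate (f ∘ on (inl G H) ∘ inj₁ ∘ terminal G) j)
    ... | inj₂ j = sym (lookup∘tabulate (f ∘ on (inr G H) ∘ inj₁ ∘ terminal H) j)

  profile-redefine : ∀ {n m} → (Fin n → Fin m) → Profile m → Profile n
  profile-redefine σ (s , X) = R.redefine-op σ s , tabulate (lookup X ∘ σ)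

  profile-redefine-correct : ∀ {n m} (σ : Fin n → Fin m) (G : TypedGraph m) c f →
                             profile (redefine σ G) c f ≡ profile-redefine σ (profile G c f)
  profile-redefine-correct σ G c f =
    cong₂ _,_ (R.state-redefine σ G (f ◂ c))
              (tabulate-cong (λ i → sym (lookup∘tabulate (f ∘ inj₁ ∘ terminal G) (σ i))))

  profile-fuse : ∀ {n} → Fin n → Fin n → Profile n → Profile n
  profile-fuse a b (s , X) = R.fuse-op a b s , X

  profile-fuse-correct : ∀ {n} (a b : Fin n) (G : TypedGraph n) c f →
    profile (fuse a b G) c f ≡
    profile-fuse a b (profile G (c ∘ on (quotient a b G)) (f ∘ on (quotient a b G)))
  profile-fuse-correct a b G c f = cong₂ _,_ (R.state-fuse a b G (f ◂ c)) refl

  Unseparated : ∀ {n} → Fin n → Fin n → Profile n → Set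
  Unseparated a b (_ , X) = lookup X a ≡ lookup X b

  Sums : ∀ {n m} → Powerset {n} → Powerset {m} → Profile (n + m) → Set
  Sums S T q = ∃ λ p → ∃ λ p′ → p ∈ₚ S × p′ ∈ₚ T × q ≡ profile-sum p p′

  sums? : ∀ {n m} (S : Powerset {n}) (T : Powerset {m}) q → Dec (Sums S T q)
  sums? S T q = ∃? λ p → ∃? λ p′ → (p ∈ₚ? S) ×-dec (p′ ∈ₚ? T) ×-dec (q ≟ profile-sum p p′)

  redefines? : ∀ {n m} (σ : Fin n → Fin m) p q → Dec (q ≡ profile-redefine σ p)
  redefines? σ p q = q ≟ profile-redefine σ p

  fuses? : ∀ {n} (a b : Fin n) p q → Dec (Unseparated a b p × q ≡ profile-fuse a b p)
  fuses? a b (s , X) q = (lookup X a ≟ᵇ lookup X b) ×-dec (q ≟ profile-fuse a b (s , X))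

  -- The attained profiles make up the state of `projection`, which thus follows all choices of the
  -- quantified set at once.
  Attained : ∀ {n} (G : TypedGraph n) → Colouring k (graph G) → Profile n → Set
  Attained G c q = ∃ λ f → profile G c f ≡ q

  attained? : ∀ {n} (G : TypedGraph n) c → Decidable (Attained G c)
  attained? G c q =
    ∃-predicate? (λ f≗g eq → trans (sym (profile-ext G c f≗g)) eq) (λ f → profile G c f ≟ q)

  projection : Recogniser k
  projection = record
    { State          = λ n → Powerset {n}
    ; finite         = λ n → finite-Subset _
    ; sum-op         = λ S T → ⟦ sums? S T ⟧
    ; redefine-op    = λ σ → image (finite-Profile _) (finite-Profile _) (redefines? σ)
    ; fuse-op        = λ a b → image (finite-Profile _) (finite-Profile _) (fuses? a b)
    ; state          = λ G c → ⟦ attained? G c ⟧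
    ; state-⊕        = λ G H c → ⟦⟧-cong (attained? (G ⊕ H) c)
        (sums? ⟦ attained? G (c ∘ on (inl G H)) ⟧ ⟦ attained? H (c ∘ on (inr G H)) ⟧)
        (sum-attained G H c)
    ; state-redefine = λ σ G c →
        image-⟦⟧ (finite-Profile _) (finite-Profile _) (redefines? σ)
                 (attained? G c) (attained? (redefine σ G) c) λ q → mk⇔
        -- Redefinition leaves the graph alone, so the same `f` serves on both sides.
        (λ { (f , refl) → _ , (f , refl) , profile-redefine-correct σ G c f })
        (λ { (_ , (f , refl) , refl) → f , profile-redefine-correct σ G c f })
    ; state-fuse     = λ a b G c →
        image-⟦⟧ (finite-Profile _) (finite-Profile _) (fuses? a b)
                 (attained? G (c ∘ on (quotient a b G))) (attained? (fuse a b G) c) (fuse-attained a b G c)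
    ; state-cong     = λ {_} {G} {H} α {c} {d} c≗ →
        ⟦⟧-cong (attained? G c) (attained? H d) (iso-attained α c≗)
    }
    where
    sum-attained : ∀ {n m} (G : TypedGraph n) (H : TypedGraph m) c q →
      Attained (G ⊕ H) c q ⇔
      Sums ⟦ attained? G (c ∘ on (inl G H)) ⟧ ⟦ attained? H (c ∘ on (inr G H)) ⟧ q
    sum-attained G H c q = mk⇔
      (λ { (f , refl) → _ , _ , ⇐ (∈-⟦⟧ (attained? G cˡ)) (f ∘ on (inl G H) , refl) ,
                                ⇐ (∈-⟦⟧ (attained? H cʳ)) (f ∘ on (inr G H) , refl) ,
                                profile-⊕ G H c f })
      (λ (_ , _ , p , p′ , eq) →
         join (⇒ (∈-⟦⟧ (attained? G cˡ)) p) (⇒ (∈-⟦⟧ (attained? H cʳ)) p′) eq)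
      where
      cˡ = c ∘ on (inl G H)
      cʳ = c ∘ on (inr G H)

      join : ∀ {p p′} → Attained G cˡ p → Attained H cʳ p′ → q ≡ profile-sum p p′ →
             Attained (G ⊕ H) c q
      -- The choices on the two summands are independent and glue to a choice on the sum.
      join (f , refl) (g , refl) refl =
        copair G H f g ,
        trans (profile-⊕ G H c _)
              (cong₂ profile-sum (profile-ext G cˡ (copair-inl G H f g))
                                 (profile-ext H cʳ (copair-inr G H f g)))

    fuse-attained : ∀ {n} (a b : Fin n) (G : TypedGraph n) c q →
      Attained (fuse a b G) c q ⇔
      (∃ λ p → Attained G (c ∘ on (quotient a b G)) p × Unseparated a b p × q ≡ profile-fuse a b p)
    fuse-attained a b G c q = mk⇔
      (λ { (f , refl) → _ , (f ∘ on (quotient a b G) , refl) ,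
           ⇐ (unseparated (f ∘ on (quotient a b G))) (cong f (quotient-identifies a b G)) ,
           profile-fuse-correct a b G c f })
      -- Restricting `f` along the section gives a set in the fusion; since `f` does not separate
      -- the fused terminals, pulling this set back recovers `f`.
      (λ { (_ , (f , refl) , sat , refl) →
           f ∘ quotient-section a b G ,
           trans (profile-fuse-correct a b G c _)
             (cong (profile-fuse a b)
               (profile-ext G _ (section∘quotient a b G f (⇒ (unseparated f) sat)))) })
      where
      unseparated : (f : Individual (graph G) → Bool) →
                    lookup (tabulate (f ∘ inj₁ ∘ terminal G)) a ≡
                    lookup (tabulate (f ∘ inj₁ ∘ terminal G)) b ⇔
                    f (inj₁ (terminal G a)) ≡ f (inj₁ (terminal G b))
      unseparated f
        rewrite lookup∘tabulate (f ∘ inj₁ ∘ terminal G) a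
              | lookup∘tabulate (f ∘ inj₁ ∘ terminal G) b = mk⇔ id id

    iso-attained : ∀ {n} {G H : TypedGraph n} (α : G ≅ H) {c d} → c ≗ d ∘ on (iso α) →
                   ∀ q → Attained G c q ⇔ Attained H d q
    iso-attained {G = G} {H} α c≗ q = mk⇔
      (λ (f , eq) → f ∘ on (iso (≅-sym α)) ,
         trans (sym (profile-cong α c≗ (λ z → cong f (sym (iso-sym α z))))) eq)
      (λ (g , eq) → g ∘ on (iso α) , trans (profile-cong α c≗ (λ _ → refl)) eq)

-- As in determinising an automaton: the outcomes of all choices of `f` are collected, and an
-- accepting one among them comes from an actual witness.
regular-∃ : ∀ {k} {P : Property (suc k)} → Regular P → Regular (λ G c → ∃ λ f → P G (f ◂ c))
regular-∃ {P = P} r = record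
  { recogniser = projection
  ; accept     = λ S → does (accepting? S)
  ; correct    = λ G c → mk⇔ (sound G c ∘ ⇒ (does≡true (accepting? ⟦ attained? G c ⟧)))
                             (⇐ (does≡true (accepting? ⟦ attained? G c ⟧)) ∘ complete G c)
  }
  where
  open Regular r
  open Projection recogniser
  module Profiles {n} = FiniteType (finite-Profile n)
  open Profiles

  Accepting : ∀ {n} → Powerset {n} → Set
  Accepting S = ∃ λ q → q ∈ₚ S × accept (proj₁ q) ≡ true

  accepting? : ∀ {n} (S : Powerset {n}) → Dec (Accepting S)
  accepting? S = ∃? (λ q → (q ∈ₚ? S) ×-dec (accept (proj₁ q) ≟ᵇ true))

  sound : ∀ {n} (G : TypedGraph n) c →
          Accepting ⟦ attained? G c ⟧ → ∃ λ f → P (graph G) (f ◂ c)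
  sound G c (q , q∈ , ok) with f , refl ← ⇒ (∈-⟦⟧ (attained? G c)) q∈ = f , ⇒ (correct G _) ok

  complete : ∀ {n} (G : TypedGraph n) c →
             (∃ λ f → P (graph G) (f ◂ c)) → Accepting ⟦ attained? G c ⟧
  complete G c (f , p) =
    profile G c f , ⇐ (∈-⟦⟧ (attained? G c)) (f , refl) , ⇐ (correct G _) p

-- A relativised quantifier, rewritten as the negation of "some `f` satisfies `P` but not `Q`". The
-- double negation on `Q` is removed by its decidability.
regular-∀ : ∀ {k} {P Q : Property (suc k)} → Regular P → Regular Q →
            Regular (λ G c → ∀ f → P G (f ◂ c) → Q G (f ◂ c))
regular-∀ r s = regular-resp
  (λ G c → mk⇔ (λ ¬∃ f p → decidable-stable (Regular.holds? s G (f ◂ c)) (λ ¬q → ¬∃ (f , p , ¬q)))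
               (λ ∀f (f , p , ¬q) → ¬q (∀f f p)))
  (regular-¬ (regular-∃ (regular-× r (regular-¬ s))))

-- Local properties

-- The second component is nothing for a vertex.
Local : ℕ → Set
Local k = Vec Bool k × Maybe (List (Vec Bool k))

end-colours : ∀ {k} (G : Graph) → Colouring k G → Individual G → Maybe (List (Vec Bool k))
end-colours G c (inj₁ x) = nothing
end-colours G c (inj₂ y) = just (List.map (c ∘ inj₁) (toList (Graph.ends G y)))

local : ∀ {k} (G : Graph) → Colouring k G → Individual G → Local k
local G c z = c z , end-colours G c z

-- Homomorphisms send vertices to vertices and map the word of an edge letter by letter, so the
-- colours read along the word are those of the pulled-back colouring.
local-hom : ∀ {k} {G H : Graph} (φ : Hom G H) (c : Colouring k H) →
            ∀ z → local H c (on φ z) ≡ local G (c ∘ on φ) z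
local-hom φ c (inj₁ x) = refl
local-hom {G = G} φ c (inj₂ y) =
  cong (λ ws → c (inj₂ (Hom.onEdge φ y)) , just ws)
       (trans (cong (List.map (c ∘ inj₁) ∘ toList) (Hom.ends φ y))
              (sym (List.map-∘ (toList (Graph.ends G y)))))

local-ext : ∀ {k} (G : Graph) {c d : Colouring k G} → c ≗ d → ∀ z → local G c z ≡ local G d z
local-ext G c≗d (inj₁ x) = cong (_, nothing) (c≗d (inj₁ x))
local-ext G c≗d (inj₂ y) =
  cong₂ (λ b ws → b , just ws) (c≗d (inj₂ y))
        (List.map-cong (c≗d ∘ inj₁) (toList (Graph.ends G y)))

Some : ∀ {k} → Pred (Local k) 0ℓ → Property k
Some p G c = ∃ λ z → p (local G c z)

module _ {k} {p : Pred (Local k) 0ℓ} where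

  some-hom : ∀ {G H : Graph} (φ : Hom G H) {c : Colouring k H} →
             Some p G (c ∘ on φ) → Some p H c
  some-hom φ {c} (z , pz) = on φ z , subst p (sym (local-hom φ c z)) pz

  some-hom⁻ : ∀ {G H : Graph} (φ : Hom G H) {c : Colouring k H} z →
              p (local H c (on φ z)) → Some p G (c ∘ on φ)
  some-hom⁻ φ {c} z pz = z , subst p (local-hom φ c z) pz

  -- Each individual of `H` has a preimage, and this has the same local data by `local-hom`. Applied
  -- to the quotient map of a fusion and to isomorphisms.
  some-surjective : ∀ {G H : Graph} (φ : Hom G H) (s : Individual H → Individual G) →
                    (∀ z → on φ (s z) ≡ z) → ∀ c → Some p H c ⇔ Some p G (c ∘ on φ)
  some-surjective {G} {H} φ s inv c = mk⇔
    (λ (z , pz) → some-hom⁻ φ (s z) (subst (p ∘ local H c) (sym (inv z)) pz))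
    (some-hom φ)

  some-ext : ∀ (G : Graph) {c d : Colouring k G} → c ≗ d → Some p G c ⇔ Some p G d
  some-ext G c≗d = mk⇔
    (λ (z , pz) → z , subst p (local-ext G c≗d z) pz)
    (λ (z , pz) → z , subst p (sym (local-ext G c≗d z)) pz)

  some-⊕ : ∀ {n m} (G : TypedGraph n) (H : TypedGraph m) c →
           Some p (graph (G ⊕ H)) c ⇔
           (Some p (graph G) (c ∘ on (inl G H)) ⊎ Some p (graph H) (c ∘ on (inr G H)))
  some-⊕ G H c = mk⇔
    (uncurry (⊕-elim G H (λ z → p (local (graph (G ⊕ H)) c z) →
                 Some p (graph G) (c ∘ on (inl G H)) ⊎ Some p (graph H) (c ∘ on (inr G H)))
       (λ z → inj₁ ∘ some-hom⁻ (inl G H) z)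
       (λ z → inj₂ ∘ some-hom⁻ (inr G H) z)))
    Sum.[ some-hom (inl G H) , some-hom (inr G H) ]

  some? : Decidable p → ∀ G c → Dec (Some p G c)
  some? p? G c = map′
    Sum.[ (λ (x , px) → inj₁ x , px) , (λ (y , py) → inj₂ y , py) ]
    (λ { (inj₁ x , px) → inj₁ (x , px) ; (inj₂ y , py) → inj₂ (y , py) })
    (any? (p? ∘ local G c ∘ inj₁) ⊎-dec any? (p? ∘ local G c ∘ inj₂))

  -- Edges have words of unbounded length, so there are infinitely many possible local data.
  -- Finiteness comes from remembering only whether some individual satisfies `p`.
  regular-Some : Decidable p → Regular (Some p)
  regular-Some p? = record
    { recogniser = record
      { State          = λ _ → Bool
      ; finite         = λ _ → finite-Bool
      ; sum-op         = _∨_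
      ; redefine-op    = λ _ → id
      ; fuse-op        = λ _ _ → id
      ; state          = λ G c → does (some? p? (graph G) c)
      ; state-⊕        = λ G H c →
          does-⇔ (some-⊕ G H c) (some? p? (graph (G ⊕ H)) c)
                 (some? p? (graph G) (c ∘ on (inl G H)) ⊎-dec
                  some? p? (graph H) (c ∘ on (inr G H)))
      ; state-redefine = λ _ _ _ → refl
      ; state-fuse     = λ a b G c →
          does-⇔ (some-surjective (quotient a b G) (quotient-section a b G)
                                  (quotient∘section a b G) c)
                 (some? p? (graph (fuse a b G)) c) (some? p? (graph G) (c ∘ on (quotient a b G)))
      ; state-cong     = λ {_} {G} {H} α {c} {d} c≗ →
          does-⇔ (⇔-sym (some-surjective (iso α) (on (iso (≅-sym α))) (iso-sym′ α) d)
                    ⇔-∘ some-ext (graph G) c≗)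
                 (some? p? (graph G) c) (some? p? (graph H) d)
      }
    ; accept  = id
    ; correct = λ G c → does≡true (some? p? (graph G) c)
    }

-- Translation of formulas

Bit : ∀ {k} → Fin k → Pred (Local k) 0ℓ
Bit x l = lookup (proj₁ l) x ≡ true

bit? : ∀ {k} (x : Fin k) → Decidable (Bit x)
bit? x l = lookup (proj₁ l) x ≟ᵇ true

IsVertex IsEdge : ∀ {k} → Pred (Local k) 0ℓ
IsVertex l = proj₂ l ≡ nothing
IsEdge   l = ¬ IsVertex l

isVertex? : ∀ {k} → Decidable (IsVertex {k})
isVertex? (_ , nothing) = yes refl
isVertex? (_ , just _)  = no λ ()

-- `Pointwise` forces equal lengths, so an edge whose length differs from the arity of `conn` is
-- rejected.
Joins : ∀ {k} → List (Fin k) → Pred (Local k) 0ℓ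
Joins xs (_ , nothing) = ⊥
Joins xs (_ , just ws) = Pointwise (λ w x → lookup w x ≡ true) ws xs

joins? : ∀ {k} (xs : List (Fin k)) → Decidable (Joins xs)
joins? xs (_ , nothing) = no λ ()
joins? xs (_ , just ws) = Pointwise.decidable (λ w x → lookup w x ≟ᵇ true) ws xs

-- Sets that encode values of variables

IsSingleton IsSet : ∀ {k} → Property (suc k)
IsSingleton G c = ∃ λ x → ∀ z → lookup (c z) zero ≡ true ⇔ z ≡ x
IsSet       G c = ∃ λ X → ∀ z → lookup (c z) zero ≡ true ⇔ Member G z X

_≟ⁱ_ : ∀ {G} → DecidableEquality (Individual G)
_≟ⁱ_ = ≡-dec _≟ᶠ_ _≟ᶠ_

member? : ∀ G z X → Dec (Member G z X)
member? G (inj₁ x) (inj₁ X) = x ∈? X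
member? G (inj₂ y) (inj₂ Y) = y ∈? Y
member? G (inj₁ _) (inj₂ _) = no λ ()
member? G (inj₂ _) (inj₁ _) = no λ ()

-- A set is a singleton iff it is nonempty and no set splits it.
module _ {k : ℕ} where

  -- Position zero holds the splitting set, position one the set to be split.
  Splits : Property (suc (suc k))
  Splits G c = Some (λ l → Bit zero l × Bit (suc zero) l) G c ×
               Some (λ l → (¬ Bit zero l) × Bit (suc zero) l) G c

  Atomic : Property (suc k)
  Atomic G c = Some (Bit zero) G c × ¬ (∃ λ f → Splits G (f ◂ c))

  regular-Splits : Regular Splits
  regular-Splits = regular-×
    (regular-Some (λ l → bit? zero l ×-dec bit? (suc zero) l))
    (regular-Some (λ l → ¬? (bit? zero l) ×-dec bit? (suc zero) l))

  regular-Atomic : Regular Atomic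
  regular-Atomic =
    regular-× (regular-Some (bit? zero)) (regular-¬ (regular-∃ {P = Splits} regular-Splits))

  atomic⇔singleton : ∀ G c → Atomic G c ⇔ IsSingleton G c
  atomic⇔singleton G c = mk⇔ singleton atomic
    where
    singleton : Atomic G c → IsSingleton G c
    -- A second member `z` would be separated from `x` by the singleton of `x`.
    singleton ((x , x∈) , unsplit) = x , λ z → mk⇔
      (λ z∈ → decidable-stable (_≟ⁱ_ {G} z x) λ z≢x →
         unsplit ((λ u → does (_≟ⁱ_ {G} u x)) ,
                  (x , dec-true (_≟ⁱ_ {G} x x) refl , x∈) ,
                  (z , (λ eq → z≢x (⇒ (does≡true (_≟ⁱ_ {G} z x)) eq)) , z∈)))
      (λ { refl → x∈ })

    atomic : IsSingleton G c → Atomic G c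
    atomic (x , only) = (x , ⇐ (only x) refl) ,
      λ { (f , (u , fu , u∈) , (v , ¬fv , v∈)) →
          ¬fv (subst (λ z → f z ≡ true)
                     (trans (⇒ (only u) u∈) (sym (⇒ (only v) v∈))) fu) }

  regular-IsSingleton : Regular IsSingleton
  regular-IsSingleton = regular-resp atomic⇔singleton regular-Atomic

module _ {k : ℕ} where

  HasEdge HasVertex : Property (suc k)
  HasEdge   = Some (λ l → IsEdge l × Bit zero l)
  HasVertex = Some (λ l → IsVertex l × Bit zero l)

  regular-HasEdge : Regular HasEdge
  regular-HasEdge = regular-Some (λ l → ¬? (isVertex? l) ×-dec bit? zero l)

  regular-HasVertex : Regular HasVertex
  regular-HasVertex = regular-Some (λ l → isVertex? l ×-dec bit? zero l)

  -- A set variable takes subsets of V or subsets of E as values, whereas a colour position can hold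
  -- any mixture. Excluding mixtures is expressible with two local properties.
  unmixed⇔isSet : ∀ G c → (¬ (HasEdge G c × HasVertex G c)) ⇔ IsSet G c
  unmixed⇔isSet G c = mk⇔ isSet unmixed
    where
    tabulated : ∀ {n} (f : Fin n → Bool) i → f i ≡ true ⇔ tabulate f Vec.[ i ]= true
    tabulated f i = mk⇔
      (λ eq → lookup⇒[]= i (tabulate f) (trans (lookup∘tabulate f i) eq))
      (λ i∈ → trans (sym (lookup∘tabulate f i)) ([]=⇒lookup i∈))

    isSet : ¬ (HasEdge G c × HasVertex G c) → IsSet G c
    isSet ¬mixed with Regular.holds? regular-HasVertex G c
    ... | yes v = inj₁ (tabulate (λ x → lookup (c (inj₁ x)) zero)) ,
        λ { (inj₁ x) → tabulated (λ x → lookup (c (inj₁ x)) zero) x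
          ; (inj₂ y) → mk⇔ (λ y∈ → ¬mixed ((inj₂ y , (λ ()) , y∈) , v)) (λ ()) }
    -- The empty set falls under this case and is read as a set of edges.
    ... | no ¬v = inj₂ (tabulate (λ y → lookup (c (inj₂ y)) zero)) ,
        λ { (inj₂ y) → tabulated (λ y → lookup (c (inj₂ y)) zero) y
          ; (inj₁ x) → mk⇔ (λ x∈ → ¬v (inj₁ x , refl , x∈)) (λ ()) }

    unmixed : IsSet G c → ¬ (HasEdge G c × HasVertex G c)
    unmixed (inj₁ X , X⇔) ((inj₂ y , _ , y∈) , _) = ⇒ (X⇔ (inj₂ y)) y∈
    unmixed (inj₁ X , X⇔) ((inj₁ _ , e , _) , _)  = e refl
    unmixed (inj₂ Y , Y⇔) (_ , (inj₁ x , _ , x∈)) = ⇒ (Y⇔ (inj₁ x)) x∈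

  regular-IsSet : Regular IsSet
  regular-IsSet =
    regular-resp unmixed⇔isSet (regular-¬ (regular-× regular-HasEdge regular-HasVertex))

-- Formulas with set variables only: ι x is the variable for the singleton of
-- the individual variable x, and κ X is the variable for X.
Holds : ∀ {i s k} → Formula i s → (Fin i → Fin k) → (Fin s → Fin k) → Property k
Holds (vert x)    ι κ     = Some (λ l → IsVertex l × Bit (ι x) l)
Holds (edge x)    ι κ     = Some (λ l → IsEdge l × Bit (ι x) l)
-- Two singletons coincide as soon as they meet.
Holds (x ≐ y)     ι κ     = Some (λ l → Bit (ι x) l × Bit (ι y) l)
Holds (X ∋ x)     ι κ     = Some (λ l → Bit (κ X) l × Bit (ι x) l)
Holds (conn y xs) ι κ     = Some (λ l → Bit (ι y) l × Joins (List.map ι (Vec.toList xs)) l)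
Holds (~ φ)       ι κ G c = ¬ Holds φ ι κ G c
Holds (φ ∧ ψ)     ι κ G c = Holds φ ι κ G c × Holds ψ ι κ G c
-- Here `f` runs over all predicates on individuals, so both quantifiers are relativised to those
-- that encode a value of the bound variable.
Holds (∀₁ φ)      ι κ G c = ∀ f → IsSingleton G (f ◂ c) →
                            Holds φ (zero Vector.∷ (suc ∘ ι)) (suc ∘ κ) G (f ◂ c)
Holds (∀₂ φ)      ι κ G c = ∀ f → IsSet G (f ◂ c) →
                            Holds φ (suc ∘ ι) (zero Vector.∷ (suc ∘ κ)) G (f ◂ c)

regular-Holds : ∀ {i s k} (φ : Formula i s) (ι : Fin i → Fin k) (κ : Fin s → Fin k) →
                Regular (Holds φ ι κ)
regular-Holds (vert x)    ι κ = regular-Some (λ l → isVertex? l ×-dec bit? (ι x) l)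
regular-Holds (edge x)    ι κ = regular-Some (λ l → ¬? (isVertex? l) ×-dec bit? (ι x) l)
regular-Holds (x ≐ y)     ι κ = regular-Some (λ l → bit? (ι x) l ×-dec bit? (ι y) l)
regular-Holds (X ∋ x)     ι κ = regular-Some (λ l → bit? (κ X) l ×-dec bit? (ι x) l)
regular-Holds (conn y xs) ι κ =
  regular-Some (λ l → bit? (ι y) l ×-dec joins? (List.map ι (Vec.toList xs)) l)
regular-Holds (~ φ)       ι κ = regular-¬ (regular-Holds φ ι κ)
regular-Holds (φ ∧ ψ)     ι κ = regular-× (regular-Holds φ ι κ) (regular-Holds ψ ι κ)
regular-Holds (∀₁ φ)      ι κ = regular-∀ regular-IsSingleton (regular-Holds φ _ _)
regular-Holds (∀₂ φ)      ι κ = regular-∀ regular-IsSet (regular-Holds φ _ _)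

-- Correctness of the translation

record Encodes {i s k : ℕ} (G : Graph) (ι : Fin i → Fin k) (κ : Fin s → Fin k)
               (ρ : Vector (Individual G) i) (θ : Vector (IndividualSet G) s)
               (c : Colouring k G) : Set where
  field
    individual : ∀ x z → lookup (c z) (ι x) ≡ true ⇔ z ≡ ρ x
    set        : ∀ X z → lookup (c z) (κ X) ≡ true ⇔ Member G z (θ X)

module _ {G : Graph} where

  encodes-∷₁ : ∀ {i s k} {ι : Fin i → Fin k} {κ : Fin s → Fin k} {ρ θ c f x} →
               (∀ z → f z ≡ true ⇔ z ≡ x) → Encodes G ι κ ρ θ c →
               Encodes G (zero Vector.∷ (suc ∘ ι)) (suc ∘ κ) (x Vector.∷ ρ) θ (f ◂ c)
  encodes-∷₁ f⇔ enc = record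
    { individual = λ { zero → f⇔ ; (suc y) → individual y }
    ; set        = set
    }
    where open Encodes enc

  encodes-∷₂ : ∀ {i s k} {ι : Fin i → Fin k} {κ : Fin s → Fin k} {ρ θ c f X} →
               (∀ z → f z ≡ true ⇔ Member G z X) → Encodes G ι κ ρ θ c →
               Encodes G (suc ∘ ι) (zero Vector.∷ (suc ∘ κ)) ρ (X Vector.∷ θ) (f ◂ c)
  encodes-∷₂ f⇔ enc = record
    { individual = individual
    ; set        = λ { zero → f⇔ ; (suc Y) → set Y }
    }
    where open Encodes enc

  -- An end point lies in the singleton for `x` exactly when it is the value of `x`; the two words
  -- are compared in this way entry by entry.
  joins⇔≡ : ∀ {i k} {ι : Fin i → Fin k} {ρ : Vector (Individual G) i} (c : Colouring k G) →
            (∀ x z → lookup (c z) (ι x) ≡ true ⇔ z ≡ ρ x) → ∀ us xs →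
            Pointwise (λ w x → lookup w x ≡ true) (List.map (c ∘ inj₁) us) (List.map ι xs) ⇔
            List.map inj₁ us ≡ List.map ρ xs
  joins⇔≡ c enc []       []       = mk⇔ (λ _ → refl) (λ _ → [])
  joins⇔≡ c enc []       (_ ∷ _)  = mk⇔ (λ ()) (λ ())
  joins⇔≡ c enc (_ ∷ _)  []       = mk⇔ (λ ()) (λ ())
  joins⇔≡ c enc (u ∷ us) (x ∷ xs) = mk⇔
    (λ { (p ∷ ps) → cong₂ _∷_ (⇒ (enc x (inj₁ u)) p) (⇒ (joins⇔≡ c enc us xs) ps) })
    (λ eq → ⇐ (enc x (inj₁ u)) (List.∷-injectiveˡ eq) ∷
            ⇐ (joins⇔≡ c enc us xs) (List.∷-injectiveʳ eq))

  -- Induction on the formula. In each atom the individual asserted to exist must lie in the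
  -- singleton for a variable, so it is the value of that variable, and that value is in turn the
  -- witness. For quantifiers, values of the bound variable correspond to their encodings.
  sat⇔holds : ∀ {i s k} (φ : Formula i s) {ι : Fin i → Fin k} {κ : Fin s → Fin k} {ρ θ c} →
              Encodes G ι κ ρ θ c → Sat G φ ρ θ ⇔ Holds φ ι κ G c
  sat⇔holds (vert x) {ρ = ρ} enc = mk⇔
    (λ v → ρ x , vertex-local v , ⇐ (individual x _) refl)
    (λ { (z , v , z∈) → subst (Ω.Vert G) (⇒ (individual x z) z∈) (local-vertex z v) })
    where
    open Encodes enc
    vertex-local : ∀ {z} → Ω.Vert G z → IsVertex (local G _ z)
    vertex-local {inj₁ _} _ = refl

    local-vertex : ∀ z → IsVertex (local G _ z) → Ω.Vert G z
    local-vertex (inj₁ _) _ = tt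
  sat⇔holds (edge x) {ρ = ρ} enc = mk⇔
    (λ e → ρ x , edge-local e , ⇐ (individual x _) refl)
    (λ { (z , e , z∈) → subst (Ω.Edg G) (⇒ (individual x z) z∈) (local-edge z e) })
    where
    open Encodes enc
    edge-local : ∀ {z} → Ω.Edg G z → IsEdge (local G _ z)
    edge-local {inj₂ _} _ ()

    local-edge : ∀ z → IsEdge (local G _ z) → Ω.Edg G z
    local-edge (inj₁ _) e = e refl
    local-edge (inj₂ _) e = tt
  sat⇔holds (x ≐ y) {ρ = ρ} enc = mk⇔
    (λ eq → ρ x , ⇐ (individual x _) refl , ⇐ (individual y _) eq)
    (λ (z , z∈x , z∈y) → trans (sym (⇒ (individual x z) z∈x)) (⇒ (individual y z) z∈y))
    where open Encodes enc
  sat⇔holds (X ∋ x) {ρ = ρ} {θ = θ} enc = mk⇔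
    (λ m → ρ x , ⇐ (set X _) m , ⇐ (individual x _) refl)
    (λ (z , z∈X , z∈x) →
       subst (λ u → Member G u (θ X)) (⇒ (individual x z) z∈x) (⇒ (set X z) z∈X))
    where open Encodes enc
  sat⇔holds (conn y xs) {ρ = ρ} {c = c} enc = mk⇔
    (λ e → ρ y , ⇐ (individual y _) refl , conn-joins (ρ y) e)
    (λ (z , z∈y , j) →
       subst (λ u → Ω.Conn G u (Vec.map ρ xs)) (⇒ (individual y z) z∈y) (joins-conn z j))
    where
    open Encodes enc
    conn-joins : ∀ z → Ω.Conn G z (Vec.map ρ xs) → Joins _ (local G c z)
    conn-joins (inj₂ e) eq =
      ⇐ (joins⇔≡ c individual (toList (Graph.ends G e)) (Vec.toList xs))
        (trans eq (toList-map ρ xs))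

    joins-conn : ∀ z → Joins _ (local G c z) → Ω.Conn G z (Vec.map ρ xs)
    joins-conn (inj₂ e) j =
      trans (⇒ (joins⇔≡ c individual (toList (Graph.ends G e)) (Vec.toList xs)) j)
            (sym (toList-map ρ xs))
  sat⇔holds (~ φ) enc = mk⇔ (λ ¬φ → ¬φ ∘ ⇐ (sat⇔holds φ enc)) (λ ¬φ → ¬φ ∘ ⇒ (sat⇔holds φ enc))
  sat⇔holds (φ ∧ ψ) enc = sat⇔holds φ enc ×-⇔ sat⇔holds ψ enc
  sat⇔holds (∀₁ φ) enc = mk⇔
    (λ sat f (x , f⇔) → ⇒ (sat⇔holds φ (encodes-∷₁ f⇔ enc)) (sat x))
    -- The predicate left implicit is the characteristic function of `x`, fixed by the type of `f⇔`.
    (λ holds x → let f⇔ = λ z → does≡true (_≟ⁱ_ {G} z x) in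
       ⇐ (sat⇔holds φ (encodes-∷₁ f⇔ enc)) (holds _ (x , f⇔)))
  sat⇔holds (∀₂ φ) enc = mk⇔
    (λ sat f (X , f⇔) → ⇒ (sat⇔holds φ (encodes-∷₂ f⇔ enc)) (sat X))
    (λ holds X → let f⇔ = λ z → does≡true (member? G z X) in
       ⇐ (sat⇔holds φ (encodes-∷₂ f⇔ enc)) (holds _ (X , f⇔)))

-- The recognising algebra of a sentence

theorem7p1p1 : (φ : Sentence) (n : ℕ) → Recognisable 𝔊 n (λ G → Ω⟨ TypedGraph.graph G ⟩⊨ φ)
theorem7p1p1 φ n = record
  { B      = record
    { carrier = λ m → setoid (State m)
    ; op      = λ where
        (sum _ _)        ss → sum-op (ss zero) (ss (suc zero))
        (redefinition σ) ss → redefine-op σ (ss zero)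
        (fusion a b)     ss → fuse-op a b (ss zero)
        vertex           _  → state 𝔳 uncoloured
        (edge m)         _  → state (𝔢 m) uncoloured
    ; op-cong = λ where
        (sum _ _)        eq → cong₂ sum-op (eq zero) (eq (suc zero))
        (redefinition σ) eq → cong (redefine-op σ) (eq zero)
        (fusion a b)     eq → cong (fuse-op a b) (eq zero)
        vertex           _  → refl
        (edge _)         _  → refl
    }
  ; finite = finite
  ; h      = record
    { hom      = λ m → record
      { to   = λ G → state G uncoloured
      ; cong = λ α → state-cong α (λ _ → refl)
      }
    ; commutes = λ where
        -- `uncoloured` ignores its argument, so its pullbacks are again `uncoloured` by
        -- computation.
        (sum _ _)        Gs → state-⊕ (Gs zero) (Gs (suc zero)) _
        (redefinition σ) Gs → state-redefine σ (Gs zero) _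
        (fusion a b)     Gs → state-fuse a b (Gs zero) _
        vertex           _  → refl
        (edge _)         _  → refl
    }
  ; M      = λ s → accept s ≡ true
  ; M-resp = λ { refl → id }
  ; L≡h⁻¹M = λ G → ⇔-sym (correct G uncoloured) ⇔-∘ sat⇔holds φ
      (record { individual = λ () ; set = λ () })
  }
  where
  -- A sentence has no free variables to encode, so there are no colour positions and each graph has
  -- a single colouring up to `≗`.
  open Regular (regular-Holds {k = 0} φ (λ ()) (λ ()))

  uncoloured : {A : Set} → A → Vec Bool 0
  uncoloured _ = []
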